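{- Let $G$ and $H$ be graphs, each with at least $2$ vertices. The direct product $G\times H$ is $1$-perfectly orientable if and only if one of the following holds: (i) $G$ is a $1$-linear forest and $H$ is arbitrary, or vice versa; (ii) $G$ is a $2$-linear forest and $H$ is a pseudoforest, or vice versa; (iii) $G$ is a $3$-linear forest and $H$ is a $4$-linear forest, or vice versa.
   Context: All graphs are finite and simple. An orientation of a graph $G$ is $1$-perfect if the out-neighborhood of every vertex induces a clique in $G$; $G$ is $1$-perfectly orientable if it admits a $1$-perfect orientation. The direct product $G\times H$ has vertex set $V(G)\times V(H)$, with $(u,v),(u',v')$ adjacent iff $uu'\in E(G)$ and $vv'\in E(H)$. For a positive integer $k$, a $k$-linear forest is a disjoint union of paths each having at most $k$ vertices (so $1$-linear forests are edgeless graphs). A pseudoforest is a graph each of whose connected components contains at most one cycle. -}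

module Defs where

open import Data.Fin.Base using (Fin; toℕ)
open import Data.Nat.Base using (ℕ; suc; _≤_)
open import Data.Nat.Properties using (1+n≢n)
open import Data.Product.Base using (Σ; ∃; ∃₂; _×_; _,_)
open import Data.Sum.Base using (_⊎_; inj₁; inj₂; swap)
open import Function.Bundles using (_⇔_; _↔_; module Inverse)
open import Function.Definitions using (Injective)
open import Level using (0ℓ)
open import Relation.Binary.Construct.Closure.ReflexiveTransitive using (Star)
open import Relation.Binary.Core using (Rel)
open import Relation.Binary.Definitions using (Decidable; Symmetric)
open import Relation.Binary.PropositionalEquality using (_≡_; _≢_)
open import Relation.Nullary.Negation.Core using (¬_)

record Graph : Set₁ where
  field
    V      : Set
    Adj    : Rel V 0ℓ
    sym    : Symmetric Adj
    irrefl : ∀ {v} → ¬ Adj v v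

open Graph public using (V; Adj)

-- Decidability of adjacency is part of finiteness: a finite graph is one
-- whose adjacency is given by a finite 0/1 matrix.
record Finite (G : Graph) : Set where
  field
    order : ℕ
    enum  : V G ↔ Fin order
    adj?  : Decidable (Adj G)

open Finite public using (order)

record _≅_ (G H : Graph) : Set where
  field
    bijection : V G ↔ V H
    adjacency : ∀ u v → Adj G u v ⇔ Adj H (Inverse.to bijection u) (Inverse.to bijection v)

record Orientation (G : Graph) : Set₁ where
  field
    Arc      : Rel (V G) 0ℓ
    arc⇒adj  : ∀ {u v} → Arc u v → Adj G u v
    oriented : ∀ {u v} → Adj G u v → Arc u v ⊎ Arc v u
    asym     : ∀ {u v} → Arc u v → ¬ Arc v u

IsClique : (G : Graph) → (V G → Set) → Set
IsClique G S = ∀ {u v} → S u → S v → u ≢ v → Adj G u v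

OnePerfect : (G : Graph) → Orientation G → Set
OnePerfect G O = ∀ v → IsClique G (Orientation.Arc O v)

OnePerfectlyOrientable : Graph → Set₁
OnePerfectlyOrientable G = Σ (Orientation G) (OnePerfect G)

infixr 7 _×ᵍ_

_×ᵍ_ : Graph → Graph → Graph
G ×ᵍ H = record
  { V      = V G × V H
  ; Adj    = λ (u , v) (u′ , v′) → Adj G u u′ × Adj H v v′
  ; sym    = λ (p , q) → Graph.sym G p , Graph.sym H q
  ; irrefl = λ (p , _) → Graph.irrefl G p
  }

data ⨆Adj {I : Set} (F : I → Graph) : Rel (Σ I (λ i → V (F i))) 0ℓ where
  within : ∀ i {u v} → Adj (F i) u v → ⨆Adj F (i , u) (i , v)

⨆ : {I : Set} → (I → Graph) → Graph
⨆ {I} F = record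
  { V      = Σ I (λ i → V (F i))
  ; Adj    = ⨆Adj F
  ; sym    = λ { (within i p) → within i (Graph.sym (F i) p) }
  ; irrefl = λ { (within i p) → Graph.irrefl (F i) p }
  }

path : ℕ → Graph
path n = record
  { V      = Fin n
  ; Adj    = λ i j → suc (toℕ i) ≡ toℕ j ⊎ suc (toℕ j) ≡ toℕ i
  ; sym    = swap
  ; irrefl = λ { (inj₁ eq) → 1+n≢n eq ; (inj₂ eq) → 1+n≢n eq }
  }

-- The components are indexed by Fin m, as only finite graphs are of interest.
LinearForest : ℕ → Graph → Set
LinearForest k G =
  ∃ λ m → Σ (Fin m → ℕ) λ ℓ →
    (∀ i → 1 ≤ ℓ i × ℓ i ≤ k) × (G ≅ ⨆ (λ i → path (ℓ i)))

CyclicSuc : (n : ℕ) → Rel (Fin n) 0ℓ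
CyclicSuc n i j = suc (toℕ i) ≡ toℕ j ⊎ (suc (toℕ i) ≡ n × toℕ j ≡ 0)

-- A cyclic list of vertices; it represents the cycle (a subgraph) given by
-- _∈V_ and ⟨_,_⟩∈E_ below, and the same cycle has several such lists.
record Cycle (G : Graph) : Set where
  field
    length     : ℕ
    3≤length   : 3 ≤ length
    vertex     : Fin length → V G
    injective  : Injective _≡_ _≡_ vertex
    successive : ∀ {i j} → CyclicSuc length i j → Adj G (vertex i) (vertex j)

module _ {G : Graph} where
  open Cycle

  _∈V_ : V G → Cycle G → Set
  v ∈V C = ∃ λ i → v ≡ vertex C i

  ⟨_,_⟩∈E_ : V G → V G → Cycle G → Set
  ⟨ u , v ⟩∈E C = ∃₂ λ i j →
    (CyclicSuc (length C) i j ⊎ CyclicSuc (length C) j i) ×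
    u ≡ vertex C i × v ≡ vertex C j

  _≈ᶜ_ : Rel (Cycle G) 0ℓ
  C ≈ᶜ D = (∀ v → v ∈V C ⇔ v ∈V D) × (∀ u v → ⟨ u , v ⟩∈E C ⇔ ⟨ u , v ⟩∈E D)

Component : (G : Graph) → V G → V G → Set
Component G r v = Star (Adj G) r v

Pseudoforest : Graph → Set
Pseudoforest G = ∀ (r : V G) (C D : Cycle G) →
  (∀ v → v ∈V C → Component G r v) →
  (∀ v → v ∈V D → Component G r v) →
  C ≈ᶜ D

{-# OPTIONS --safe #-}
module Submission where

-- Two edges a-b-c and x-y-z span an induced 4-cycle in G × H, which a 1-perfect
-- orientation must make directed. If neither factor is a 2-linear forest, such
-- squares overlap, and comparing their directions excludes vertices of degree 3
-- and nonbacktracking walks with 4 edges in either factor, and walks with 3 edges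
-- in both; what remains are linear forests. If G has an edge ab, then every cycle
-- of H lifts to directed closed walks in {a,b} × H. Following arcs from any vertex
-- of the component leads into the lift of the cycle and never leaves it, so the
-- component of H has only one cycle.
--
-- Conversely, a pseudoforest has an orientation with out-degree at most 1. It is
-- built edge by edge: if following arcs from one end of a new edge stops at a
-- vertex without out-arc, reversing the arcs met frees that end to be the tail of
-- the new edge; otherwise the new edge would close a second cycle. Multiplying by
-- a matching preserves out-degrees, and P₃ × P₄ is oriented explicitly.

open import Data.Bool.Base using (Bool; true; false; not)
open import Data.Bool.Properties using (not-involutive)
open import Data.Empty using (⊥; ⊥-elim)
open import Data.Fin.Base as Fin using (Fin; zero; suc; toℕ)
open import Data.Fin.Patterns using (0F; 1F; 2F; 3F)
import Data.Fin.Properties as Fin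
open import Data.List.Base using (List; []; _∷_; map; allFin; cartesianProduct)
open import Data.List.Membership.Propositional using (_∈_)
open import Data.List.Membership.Propositional.Properties using (∈-map⁺; ∈-allFin; ∈-cartesianProduct⁺)
open import Data.List.Relation.Unary.All as All using (All; []; _∷_)
open import Data.Nat.Base using (ℕ; zero; suc; _+_; _*_; _∸_; _≤_; _<_; z≤n; s≤s; NonZero; >-nonZero)
open import Data.Nat.DivMod using (_%_; _mod_; m%n<n; m%n%n≡m%n; n%n≡0; m<n⇒m%n≡m; [m+kn]%n≡m%n; %-distribˡ-+)
import Data.Nat.Properties as ℕ
open import Data.Nat.Properties using (anyUpTo?; suc-injective; m≤n+m; ≤-refl; ≤-trans; ≤-reflexive; +-comm; +-suc; +-assoc; +-identityʳ; m+[n∸m]≡n; m≤n⇒m<n∨m≡n; 1+n≰n; +-cancelˡ-≡; +-monoʳ-≤; m<1+n⇒m≤n; <⇒≤; m≤m*n; m∸n+n≡m; *-assoc; *-comm)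
open import Data.Product.Base using (Σ; ∃; ∃₂; _×_; _,_; proj₁; proj₂; swap)
open import Data.Product.Properties using (≡-dec)
open import Data.Sum.Base as Sum using (_⊎_; inj₁; inj₂; [_,_]′)
open import Function.Base using (_∘_; id)
open import Function.Bundles using (_⇔_; mk⇔; mk↔ₛ′; module Inverse; module Equivalence)
open import Function.Definitions using (Injective)
open import Level using (0ℓ)
open import Relation.Binary.Construct.Closure.ReflexiveTransitive as Star using (Star; ε; _◅_; _◅◅_)
open import Relation.Binary.Core using (Rel; _⇒_)
open import Relation.Binary.Definitions using (DecidableEquality; Symmetric)
open import Relation.Binary.PropositionalEquality using (_≡_; _≢_; refl; sym; trans; cong; cong₂; subst; subst₂; ≢-sym)
open import Relation.Nullary using (¬_; Dec; yes; no; map′; ¬?; from-yes; _→-dec_; decidable-stable; _×-dec_; _⊎-dec_)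
open import Relation.Unary using (Decidable)
open import Defs

-- Decidability in finite graphs

module FiniteGraph {G : Graph} (fin : Finite G) where
  open Finite fin public using (adj?)
  open Finite fin using (enum)
  open Inverse enum public using () renaming (to to index)
  open Inverse enum using (from; strictlyInverseʳ)

  index-injective : Injective _≡_ _≡_ index
  index-injective {u} {v} eq =
    trans (sym (strictlyInverseʳ u)) (trans (cong from eq) (strictlyInverseʳ v))

  infix 4 _≟_
  _≟_ : DecidableEquality (V G)
  u ≟ v = map′ index-injective (cong index) (index u Fin.≟ index v)

  any? : {P : V G → Set} → Decidable P → Dec (∃ P)
  any? {P} P? = map′
    (λ (i , p) → from i , p)
    (λ (v , p) → index v , subst P (sym (strictlyInverseʳ v)) p)
    (Fin.any? (P? ∘ from))

  vertices : List (V G)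
  vertices = map from (allFin (order fin))

  ∈-vertices : ∀ v → v ∈ vertices
  ∈-vertices v = subst (_∈ vertices) (strictlyInverseʳ v) (∈-map⁺ from (∈-allFin (index v)))

-- A nonbacktracking walk with n edges, the first of which goes from u to v.
-- It may be closed: a cycle carries such walks of every length.
data NBWalk (G : Graph) : ℕ → V G → V G → Set where
  edge : ∀ {u v} → Adj G u v → NBWalk G 1 u v
  step : ∀ {n u v w} → Adj G u v → u ≢ w → NBWalk G n v w → NBWalk G (suc n) u v

Claw : (G : Graph) → V G → Set
Claw G v = ∃ λ x → ∃ λ y → ∃ λ z →
  Adj G v x × Adj G v y × Adj G v z × x ≢ y × x ≢ z × y ≢ z

Triangle : Graph → Set
Triangle G = ∃ λ a → ∃ λ b → ∃ λ c → Adj G a b × Adj G b c × Adj G a c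

module _ {G : Graph} (fin : Finite G) where
  open FiniteGraph fin

  nbWalk? : ∀ n u v → Dec (NBWalk G n u v)
  nbWalk? zero u v = no λ ()
  nbWalk? (suc zero) u v = map′ edge (λ { (edge p) → p }) (adj? u v)
  nbWalk? (suc (suc n)) u v = map′
    (λ (p , _ , q , r) → step p q r)
    (λ { (step p q r) → p , _ , q , r })
    (adj? u v ×-dec any? λ w → ¬? (u ≟ w) ×-dec nbWalk? (suc n) v w)

  hasNBWalk? : ∀ n → Dec (∃₂ (NBWalk G n))
  hasNBWalk? n = any? λ u → any? λ v → nbWalk? n u v

  triangle? : Dec (Triangle G)
  triangle? = any? λ a → any? λ b → any? λ c → adj? a b ×-dec (adj? b c ×-dec adj? a c)

-- Linear forests from degree and walk bounds

path-connected : ∀ {n} (i j : Fin n) → Star (Adj (path n)) i j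
path-connected {suc n} i j =
  toZero i ◅◅ Star.reverse (Graph.sym (path (suc n))) (toZero j)
  where
  toZero : ∀ {n} (i : Fin (suc n)) → Star (Adj (path (suc n))) i zero
  toZero zero = ε
  toZero {suc n} (suc i) =
    Star.gmap suc (Sum.map (cong suc) (cong suc)) (toZero i) ◅◅ inj₂ refl ◅ ε

-- By `closed` no edge leaves the path, and with `injective` it has no chords.
record PathComponent (G : Graph) (n : ℕ) : Set where
  field
    vertex    : Fin n → V G
    injective : Injective _≡_ _≡_ vertex
    adjacent  : ∀ {i j} → Adj (path n) i j → Adj G (vertex i) (vertex j)
    closed    : ∀ {i w} → Adj G (vertex i) w → ∃ λ j → Adj (path n) i j × w ≡ vertex j

  Member : V G → Set
  Member v = ∃ λ i → v ≡ vertex i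

  member-closed : ∀ {u v} → Star (Adj G) u v → Member u → Member v
  member-closed ε m = m
  member-closed (p ◅ ps) (i , refl) with closed p
  ... | j , _ , eq = member-closed ps (j , eq)

  connected : ∀ i j → Star (Adj G) (vertex i) (vertex j)
  connected i j = Star.gmap vertex adjacent (path-connected i j)

open PathComponent using (Member; member-closed; connected)

isolated : ∀ {G v} → (∀ {w} → ¬ Adj G v w) → PathComponent G 1
isolated {v = v} none = record
  { vertex    = λ _ → v
  ; injective = λ { {zero} {zero} _ → refl }
  ; adjacent  = λ { {zero} {zero} (inj₁ ()) ; {zero} {zero} (inj₂ ()) }
  ; closed    = λ p → ⊥-elim (none p)
  }

-- A path known to be a component of G except for further neighbours of its
-- vertex 0, where it is extended. Since the neighbours of the other vertices
-- are exhausted, an extension never runs into the path itself.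
record Trail (G : Graph) (n : ℕ) : Set where
  field
    vertex    : Fin (2 + n) → V G
    injective : Injective _≡_ _≡_ vertex
    adjacent  : ∀ {i j} → Adj (path (2 + n)) i j → Adj G (vertex i) (vertex j)
    closed    : ∀ {i w} → Adj G (vertex (suc i)) w →
                ∃ λ j → Adj (path (2 + n)) (suc i) j × w ≡ vertex j
    walk      : NBWalk G (suc n) (vertex zero) (vertex (suc zero))

module _ {G : Graph} where

  start : ∀ {u v} → Adj G u v → (∀ {w} → Adj G v w → w ≡ u) → Trail G 0
  start {u} {v} p only = record
    { vertex    = vertex
    ; injective = λ
      { {zero} {zero} _ → refl
      ; {zero} {suc zero} refl → ⊥-elim (Graph.irrefl G p)
      ; {suc zero} {zero} refl → ⊥-elim (Graph.irrefl G p)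
      ; {suc zero} {suc zero} _ → refl }
    ; adjacent  = λ
      { {zero} {zero} (inj₁ ())
      ; {zero} {zero} (inj₂ ())
      ; {zero} {suc zero} _ → p
      ; {suc zero} {zero} _ → Graph.sym G p
      ; {suc zero} {suc zero} (inj₁ ())
      ; {suc zero} {suc zero} (inj₂ ()) }
    ; closed    = λ { {zero} q → zero , inj₂ refl , only q }
    ; walk      = edge p
    }
    where
    vertex : Fin 2 → V G
    vertex zero = u
    vertex (suc zero) = v

  finish : ∀ {n} (t : Trail G n) → let open Trail t in
    (∀ {w} → Adj G (vertex zero) w → w ≡ vertex (suc zero)) → PathComponent G (2 + n)
  finish t only = record
    { vertex = vertex ; injective = injective ; adjacent = adjacent
    ; closed = λ { {zero} p → suc zero , inj₁ refl , only p ; {suc i} p → closed p } }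
    where open Trail t

  extend : ∀ {n} (t : Trail G n) → let open Trail t in
    (∀ {x y z} → Adj G (vertex zero) x → Adj G (vertex zero) y → Adj G (vertex zero) z →
      x ≢ y → z ≡ x ⊎ z ≡ y) →
    ∀ {w} → Adj G (vertex zero) w → w ≢ vertex (suc zero) → Trail G (suc n)
  extend {n} t two {w} p w≢ = record
    { vertex    = vertex′
    ; injective = λ
      { {zero} {zero} _ → refl
      ; {zero} {suc i} eq → ⊥-elim (new i eq)
      ; {suc i} {zero} eq → ⊥-elim (new i (sym eq))
      ; {suc i} {suc j} eq → cong suc (injective eq) }
    ; adjacent  = adjacent′
    ; closed    = closed′
    ; walk      = step (Graph.sym G p) w≢ walk
    }
    where
    open Trail t

    vertex′ : Fin (3 + n) → V G
    vertex′ zero = w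
    vertex′ (suc i) = vertex i

    new : ∀ i → w ≢ vertex i
    new zero refl = Graph.irrefl G p
    new (suc i) refl with closed (Graph.sym G p)
    ... | j , q , eq with injective {zero} {j} eq
    new (suc zero) refl | .zero , inj₂ refl , eq | refl = w≢ refl

    adjacent′ : ∀ {i j} → Adj (path (3 + n)) i j → Adj G (vertex′ i) (vertex′ j)
    adjacent′ {zero} {zero} (inj₁ ())
    adjacent′ {zero} {zero} (inj₂ ())
    adjacent′ {zero} {suc zero} _ = Graph.sym G p
    adjacent′ {zero} {suc (suc _)} (inj₁ ())
    adjacent′ {zero} {suc (suc _)} (inj₂ ())
    adjacent′ {suc zero} {zero} _ = p
    adjacent′ {suc (suc _)} {zero} (inj₁ ())
    adjacent′ {suc (suc _)} {zero} (inj₂ ())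
    adjacent′ {suc i} {suc j} q = adjacent (Sum.map suc-injective suc-injective q)

    closed′ : ∀ {i u} → Adj G (vertex i) u →
      ∃ λ j → Adj (path (3 + n)) (suc i) j × u ≡ vertex′ j
    closed′ {zero} q with two p (adjacent (inj₁ refl)) q w≢
    ... | inj₁ eq = zero , inj₂ refl , eq
    ... | inj₂ eq = suc (suc zero) , inj₁ refl , eq
    closed′ {suc i} q with closed q
    ... | j , r , eq = suc j , Sum.map (cong suc) (cong suc) r , eq

module _ {G : Graph} (fin : Finite G) {k : ℕ}
         (noClaw : ∀ {v} → ¬ Claw G v)
         (noWalk : ∀ {u v} → ¬ NBWalk G (suc k) u v) where
  open FiniteGraph fin

  private
    two : ∀ {v x y z} → Adj G v x → Adj G v y → Adj G v z → x ≢ y → z ≡ x ⊎ z ≡ y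
    two {v} {x} {y} {z} p q r x≢y with z ≟ x | z ≟ y
    ... | yes eq | _ = inj₁ eq
    ... | no _ | yes eq = inj₂ eq
    ... | no z≢x | no z≢y =
      ⊥-elim (noClaw (x , y , z , p , q , r , x≢y , ≢-sym z≢x , ≢-sym z≢y))

    another? : ∀ u v → (∃ λ w → Adj G u w × w ≢ v) ⊎ (∀ {w} → Adj G u w → w ≡ v)
    another? u v with any? (λ w → adj? u w ×-dec ¬? (w ≟ v))
    ... | yes found = inj₁ found
    ... | no none = inj₂ λ {w} p → only w p
      where
      only : ∀ w → Adj G u w → w ≡ v
      only w p with w ≟ v
      ... | yes eq = eq
      ... | no w≢v = ⊥-elim (none (w , p , w≢v))

    -- Each extension adds an edge to the nonbacktracking walk of the trail; `d` counts the edges it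
    -- may still gain before reaching the forbidden `suc k`.
    complete : ∀ d {n} → d + suc n ≡ suc k → (t : Trail G n) →
      ∃ λ ℓ → (1 ≤ ℓ × ℓ ≤ suc k) ×
        Σ (PathComponent G ℓ) λ B → ∀ i → Member B (Trail.vertex t i)
    complete zero refl t = ⊥-elim (noWalk (Trail.walk t))
    complete (suc d) {n} eq t with another? (Trail.vertex t zero) (Trail.vertex t (suc zero))
    ... | inj₂ only =
      2 + n , (s≤s z≤n , subst (2 + n ≤_) eq (s≤s (m≤n+m (suc n) d))) ,
      finish t only , λ i → i , refl
    ... | inj₁ (w , p , w≢)
      with complete d (trans (+-suc d (suc n)) eq) (extend t two p w≢)
    ... | ℓ , bounds , B , sub = ℓ , bounds , B , sub ∘ suc

    -- A walk prolonged at its first vertex can stop only at a leaf, and it must stop before it has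
    -- `suc k` edges.
    findEnd : ∀ d {n u v x} → d + n ≡ suc k → NBWalk G n u v → Star (Adj G) u x →
      ∃₂ λ e p → Adj G p e × (∀ {w} → Adj G e w → w ≡ p) × Star (Adj G) e x
    findEnd zero refl walk _ = ⊥-elim (noWalk walk)
    findEnd (suc d) {n} {u} {v} eq walk s with another? u v
    ... | inj₂ only = u , v , Graph.sym G (first walk) , only , s
      where
      first : ∀ {n u v} → NBWalk G n u v → Adj G u v
      first (edge p) = p
      first (step p _ _) = p
    ... | inj₁ (w , p , w≢v) =
      findEnd d (trans (+-suc d n) eq) (step (Graph.sym G p) w≢v walk) (Graph.sym G p ◅ s)

  -- The search for a leaf comes first, so that the trail started there has a single open end.
  componentOf : ∀ v →
    ∃ λ ℓ → (1 ≤ ℓ × ℓ ≤ suc k) × Σ (PathComponent G ℓ) λ B → Member B v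
  componentOf v with any? (adj? v)
  ... | no none = 1 , (≤-refl , s≤s z≤n) , isolated (λ p → none (_ , p)) , zero , refl
  ... | yes (u , p) with findEnd k (+-comm k 1) (edge (Graph.sym G p)) (Graph.sym G p ◅ ε)
  ... | e , q , r , only , s with complete k (+-comm k 1) (start r only)
  ... | ℓ , bounds , B , sub = ℓ , bounds , B , member-closed B s (sub (suc zero))

  private
    record Family : Set where
      field
        size     : ℕ
        len      : Fin size → ℕ
        bounds   : ∀ i → 1 ≤ len i × len i ≤ suc k
        comp     : ∀ i → PathComponent G (len i)
        disjoint : ∀ {i j v} → Member (comp i) v → Member (comp j) v → i ≡ j

      Covered : V G → Set
      Covered v = ∃ λ i → Member (comp i) v

    open Family

    covered? : ∀ F → Decidable (Covered F)
    covered? F v = Fin.any? λ i → Fin.any? λ j → v ≟ PathComponent.vertex (comp F i) j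

    insert : ∀ (F : Family) {v ℓ} → ¬ Covered F v → 1 ≤ ℓ × ℓ ≤ suc k →
      (B : PathComponent G ℓ) → Member B v → Family
    insert F {v} {ℓ} ¬cov bnd B v∈B = record
      { size = suc (size F)
      ; len = len′
      ; bounds = λ { zero → bnd ; (suc i) → bounds F i }
      ; comp = comp′
      ; disjoint = λ
        { {zero} {zero} _ _ → refl
        ; {zero} {suc j} m n → ⊥-elim (apart m n)
        ; {suc i} {zero} m n → ⊥-elim (apart n m)
        ; {suc i} {suc j} m n → cong suc (disjoint F m n) }
      }
      where
      len′ : Fin (suc (size F)) → ℕ
      len′ zero = ℓ
      len′ (suc i) = len F i

      comp′ : ∀ i → PathComponent G (len′ i)
      comp′ zero = B
      comp′ (suc i) = comp F i

      -- A common vertex would connect `v`, through `B`, to the older component, which is closed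
      -- under adjacency and so would cover `v`.
      apart : ∀ {i w} → Member B w → ¬ Member (comp F i) w
      apart {i} (a , refl) m = let (b , eq) = v∈B in
        ¬cov (i , subst (Member (comp F i)) (sym eq) (member-closed (comp F i) (connected B a b) m))

    family : ∀ vs → Σ Family λ F → All (Covered F) vs
    family [] = record
      { size = 0 ; len = λ () ; bounds = λ () ; comp = λ () ; disjoint = λ { {()} } } , []
    family (v ∷ vs) with family vs
    ... | F , covs with covered? F v
    ... | yes cov = F , cov ∷ covs
    ... | no ¬cov with componentOf v
    ... | ℓ , bnd , B , v∈B =
      insert F ¬cov bnd B v∈B , (zero , v∈B) ∷ All.map (λ (i , m) → suc i , m) covs

  linearForest : LinearForest (suc k) G
  linearForest with family vertices
  ... | F , covs = size F , len F , bounds F , record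
    { bijection = mk↔ₛ′ to from to-from from-to
    ; adjacency = λ u v → mk⇔ (forth u v) (back u v)
    }
    where
    W : Set
    W = Σ (Fin (size F)) λ i → Fin (len F i)

    from : W → V G
    from (i , a) = PathComponent.vertex (comp F i) a

    cov : ∀ v → Covered F v
    cov v = All.lookup covs (∈-vertices v)

    to : V G → W
    to v = let (i , a , _) = cov v in i , a

    from-to : ∀ v → from (to v) ≡ v
    from-to v = let (_ , _ , eq) = cov v in sym eq

    from-injective : ∀ {x y} → from x ≡ from y → x ≡ y
    from-injective {i , a} {j , b} eq with disjoint F {i} {j} (a , refl) (b , eq)
    ... | refl = cong (i ,_) (PathComponent.injective (comp F i) eq)

    to-from : ∀ x → to (from x) ≡ x
    to-from x = from-injective (from-to (from x))

    forth′ : ∀ {x y} → Adj G (from x) (from y) → ⨆Adj (path ∘ len F) x y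
    forth′ {i , a} {y} p with PathComponent.closed (comp F i) p
    ... | b , q , eq with from-injective {y} {i , b} eq
    ... | refl = within i q

    forth : ∀ u v → Adj G u v → ⨆Adj (path ∘ len F) (to u) (to v)
    forth u v p = forth′ (subst₂ (Adj G) (sym (from-to u)) (sym (from-to v)) p)

    back′ : ∀ {x y} → ⨆Adj (path ∘ len F) x y → Adj G (from x) (from y)
    back′ (within i q) = PathComponent.adjacent (comp F i) q

    back : ∀ u v → ⨆Adj (path ∘ len F) (to u) (to v) → Adj G u v
    back u v q = subst₂ (Adj G) (from-to u) (from-to v) (back′ q)

-- Obstructions in the direct product

×ᵍ-swap : ∀ {G H} → OnePerfectlyOrientable (G ×ᵍ H) → OnePerfectlyOrientable (H ×ᵍ G)
×ᵍ-swap {G} {H} (O , perfect) =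
  record
    { Arc      = λ x y → Arc (swap x) (swap y)
    ; arc⇒adj  = swap ∘ arc⇒adj
    ; oriented = oriented ∘ swap
    ; asym     = asym
    } ,
  λ v p q u≢w → swap (perfect (swap v) p q (u≢w ∘ cong swap))
  where open Orientation O

module Squares {G H : Graph} (orientable : OnePerfectlyOrientable (G ×ᵍ H)) where
  open Orientation (proj₁ orientable) public
  private
    perfect = proj₂ orientable
    symᴳ = λ {u v} → Graph.sym G {u} {v}
    symᴴ = λ {u v} → Graph.sym H {u} {v}

  -- Vertices that share a coordinate are never adjacent in the product, so two such out-neighbours
  -- must coincide. Equality is not assumed decidable here, hence the double negation.
  noForkˡ : ∀ {s u v y} → Arc s (u , y) → Arc s (v , y) → ¬ u ≢ v
  noForkˡ p q u≢v = Graph.irrefl H (proj₂ (perfect _ p q (u≢v ∘ cong proj₁)))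

  noForkʳ : ∀ {s u x y} → Arc s (u , x) → Arc s (u , y) → ¬ x ≢ y
  noForkʳ p q x≢y = Graph.irrefl G (proj₁ (perfect _ p q (x≢y ∘ cong proj₂)))

  fork-adjacent : ∀ {s u v x y} → Arc s (u , x) → Arc s (v , y) → u ≢ v → Adj G u v
  fork-adjacent p q u≢v = proj₁ (perfect _ p q (u≢v ∘ cong proj₁))

  private
    -- Around a square, an arc leaving a vertex forces the other edge there to enter it, or there
    -- would be a fork.
    previousˡ : ∀ {b c x y a} → Adj G b c → a ≢ c → Adj H x y →
      Arc (b , x) (a , y) → Arc (c , y) (b , x)
    previousˡ bc a≢c xy p with oriented (bc , xy)
    ... | inj₁ q = ⊥-elim (noForkˡ p q a≢c)
    ... | inj₂ q = q

    previousʳ : ∀ {a b x y z} → Adj G a b → Adj H y z → x ≢ z →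
      Arc (a , y) (b , x) → Arc (b , z) (a , y)
    previousʳ ab yz x≢z p with oriented (ab , yz)
    ... | inj₁ q = ⊥-elim (noForkʳ p q x≢z)
    ... | inj₂ q = q

  -- The vertices (b , x), (a , y), (b , z), (c , y) form an induced 4-cycle,
  -- so a 1-perfect orientation turns it into a directed cycle.
  module _ {a b c x y z}
           (ab : Adj G a b) (bc : Adj G b c) (a≢c : a ≢ c)
           (xy : Adj H x y) (yz : Adj H y z) (x≢z : x ≢ z) where

    -- Three steps back round a directed 4-cycle are one step forward.
    nextʳ : Arc (b , x) (a , y) → Arc (a , y) (b , z)
    nextʳ = previousˡ (symᴳ ab) (≢-sym a≢c) (symᴴ yz)
          ∘ previousʳ (symᴳ bc) yz x≢z
          ∘ previousˡ bc a≢c xy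

    nextˡ : Arc (a , y) (b , x) → Arc (b , x) (c , y)
    nextˡ = previousʳ (symᴳ bc) (symᴴ xy) (≢-sym x≢z)
          ∘ previousˡ bc a≢c (symᴴ yz)
          ∘ previousʳ ab yz x≢z

    -- Whichever way the square runs, `(b , x)` has an out-arc in it. This lets squares that share a
    -- vertex be compared.
    leaves : Arc (b , x) (a , y) ⊎ Arc (b , x) (c , y)
    leaves with oriented (symᴳ ab , xy)
    ... | inj₁ p = inj₁ p
    ... | inj₂ p = inj₂ (nextˡ p)

  -- The squares over `x`-`y`-`z` and `x`-`y`-`w` share the arc leaving `(b , x)`, and both continue
  -- from its head: to `(b , z)` and to `(b , w)`, a fork.
  noClaw : ∀ {u v} → NBWalk G 2 u v → ∀ {y} → ¬ Claw H y
  noClaw (step _ _ (step _ _ ()))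
  noClaw (step ab a≢c (edge bc)) (x , z , w , yx , yz , yw , x≢z , x≢w , z≢w)
    with leaves ab bc a≢c (symᴴ yx) yz x≢z
  ... | inj₁ p = noForkʳ (nextʳ ab bc a≢c (symᴴ yx) yz x≢z p)
                         (nextʳ ab bc a≢c (symᴴ yx) yw x≢w p) z≢w
  ... | inj₂ p = noForkʳ (nextʳ (symᴳ bc) (symᴳ ab) (≢-sym a≢c) (symᴴ yx) yz x≢z p)
                         (nextʳ (symᴳ bc) (symᴳ ab) (≢-sym a≢c) (symᴴ yx) yw x≢w p) z≢w

  -- Two squares meet in `(b , x)`, where `x` is the middle of the walk. Their arcs out of it lie
  -- over the same vertex of `G`, which gives a fork, or over `a` and `c`, which closes a triangle.
  noNBWalk₄ : ¬ Triangle G → ∀ {u v} → NBWalk G 2 u v → ∀ {x y} → ¬ NBWalk H 4 x y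
  noNBWalk₄ _ (step _ _ (step _ _ ()))
  noNBWalk₄ _ _ (step _ _ (step _ _ (step _ _ (step _ _ ()))))
  noNBWalk₄ ¬△ (step {u = a} {b} {c} ab a≢c (edge bc))
    (step vw v≢x (step wx w≢y (step xy x≢z (edge yz))))
    with leaves ab bc a≢c (symᴴ wx) (symᴴ vw) (≢-sym v≢x) | leaves ab bc a≢c xy yz x≢z
  ... | inj₁ p | inj₁ q = noForkʳ p q w≢y
  ... | inj₁ p | inj₂ q = ¬△ (a , b , c , ab , bc , fork-adjacent p q a≢c)
  ... | inj₂ p | inj₁ q = ¬△ (a , b , c , ab , bc , fork-adjacent q p a≢c)
  ... | inj₂ p | inj₂ q = noForkʳ p q w≢y

  -- The edge between `(b , y)` and `(c , x)` lies on two squares, over `a`-`b`-`c` and `w`-`x`-`y`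
  -- and over `b`-`c`-`d` and `x`-`y`-`z`. Both continue from its head, to out-neighbours that make
  -- `a`, `c` or `b`, `d` adjacent.
  noNBWalk₃₃ : ¬ Triangle G → ∀ {u v} → NBWalk G 3 u v → ∀ {x y} → ¬ NBWalk H 3 x y
  noNBWalk₃₃ _ (step _ _ (step _ _ (step _ _ ())))
  noNBWalk₃₃ _ _ (step _ _ (step _ _ (step _ _ ())))
  noNBWalk₃₃ ¬△ (step {u = a} {b} {c} ab a≢c (step {w = d} bc b≢d (edge cd)))
    (step wx w≢y (step xy x≢z (edge yz)))
    with oriented (bc , symᴴ xy)
  ... | inj₂ p = ¬△ (a , b , c , ab , bc , fork-adjacent
          (nextˡ (symᴳ bc) (symᴳ ab) (≢-sym a≢c) (symᴴ xy) (symᴴ wx) (≢-sym w≢y) p)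
          (nextʳ bc cd b≢d xy yz x≢z p) a≢c)
  ... | inj₁ p = ¬△ (b , c , d , bc , cd , fork-adjacent
          (nextʳ (symᴳ bc) (symᴳ ab) (≢-sym a≢c) (symᴴ xy) (symᴴ wx) (≢-sym w≢y) p)
          (nextˡ bc cd b≢d xy yz x≢z p) b≢d)

  private
    -- An arc from (b , x) to (a , y) forces one to (c , z). The edge between
    -- these two cannot be oriented: either end would need another
    -- out-neighbour, which could only be (b , x).
    noDiagonal : ∀ {a b c x y z} →
      Adj G a b → Adj G b c → Adj G a c → Adj H x y → Adj H y z → Adj H x z →
      ¬ Arc (b , x) (a , y)
    noDiagonal ab bc ac xy yz xz p = split (oriented (ac , yz))
      where
      ≢ᴳ : ∀ {u v} → Adj G u v → u ≢ v
      ≢ᴳ uv refl = Graph.irrefl G uv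
      ≢ᴴ : ∀ {u v} → Adj H u v → u ≢ v
      ≢ᴴ uv refl = Graph.irrefl H uv
      q : Arc _ _
      q with leaves ab bc (≢ᴳ ac) xz (symᴴ yz) (≢ᴴ xy)
      ... | inj₁ r = ⊥-elim (noForkʳ p r (≢ᴴ yz))
      ... | inj₂ r = r
      split : _ ⊎ _ → ⊥
      split (inj₁ r) with leaves (symᴳ ab) ac (≢ᴳ bc) (symᴴ xy) xz (≢ᴴ yz)
      ... | inj₁ s = asym p s
      ... | inj₂ s = noForkʳ r s (≢-sym (≢ᴴ xz))
      split (inj₂ r) with leaves bc (symᴳ ac) (≢-sym (≢ᴳ ab)) (symᴴ xz) xy (≢-sym (≢ᴴ yz))
      ... | inj₁ s = asym q s
      ... | inj₂ s = noForkʳ r s (≢-sym (≢ᴴ xy))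

  noTriangles : Triangle G → ¬ Triangle H
  noTriangles (a , b , c , ab , bc , ac) (x , y , z , xy , yz , xz)
    with leaves ab bc (λ { refl → Graph.irrefl G ac }) xy yz (λ { refl → Graph.irrefl H xz })
  ... | inj₁ p = noDiagonal ab bc ac xy yz xz p
  ... | inj₂ p = noDiagonal (symᴳ bc) (symᴳ ab) (symᴳ ac) xy yz xz p

triangle⇒NBWalk₄ : ∀ {G} → Triangle G → ∃₂ (NBWalk G 4)
triangle⇒NBWalk₄ {G} (a , b , c , ab , bc , ac) = a , b ,
  step ab (λ { refl → Graph.irrefl G ac })
  (step bc (λ { refl → Graph.irrefl G ab })
  (step (Graph.sym G ac) (λ { refl → Graph.irrefl G bc })
  (edge ab)))

-- Cycles in a direct product with an edge

CyclicSuc-irreflexive₂ : ∀ {n} {i j k : Fin n} → 3 ≤ n →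
  CyclicSuc n i j → CyclicSuc n j k → i ≢ k
CyclicSuc-irreflexive₂ 3≤n p q refl = go p q 3≤n
  where
  go : ∀ {n i j} → suc i ≡ j ⊎ (suc i ≡ n × j ≡ 0) → suc j ≡ i ⊎ (suc j ≡ n × i ≡ 0) → ¬ 3 ≤ n
  go (inj₁ refl) (inj₁ eq) _ = 1+n≰n (≤-trans (m≤n+m _ 1) (≤-reflexive eq))
  go (inj₁ refl) (inj₂ (refl , refl)) (s≤s (s≤s ()))
  go (inj₂ (refl , refl)) (inj₁ refl) (s≤s (s≤s ()))
  go (inj₂ (refl , refl)) (inj₂ (refl , _)) (s≤s ())

-- The cycle as a periodic walk indexed by the natural numbers, which can be followed past its
-- closing edge without case distinctions.
module Unrolled {G : Graph} (C : Cycle G) where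
  open Cycle C

  instance
    length-nonZero : NonZero length
    length-nonZero = >-nonZero (≤-trans (s≤s z≤n) 3≤length)

  at : ℕ → V G
  at i = vertex (i mod length)

  toℕ-mod : ∀ i → toℕ (i mod length) ≡ i % length
  toℕ-mod i = Fin.toℕ-fromℕ< (m%n<n i length)

  suc-% : ∀ i → suc i % length ≡ suc (i % length) % length
  suc-% i = trans (%-distribˡ-+ 1 i length)
    (trans (cong (λ j → (1 % length + j) % length) (sym (m%n%n≡m%n i length)))
           (sym (%-distribˡ-+ 1 (i % length) length)))

  cyclicSuc : ∀ i → CyclicSuc length (i mod length) (suc i mod length)
  cyclicSuc i rewrite toℕ-mod i | toℕ-mod (suc i) | suc-% i with m≤n⇒m<n∨m≡n (m%n<n i length)
  ... | inj₁ lt = inj₁ (sym (m<n⇒m%n≡m lt))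
  ... | inj₂ eq = inj₂ (eq , trans (cong (_% length) eq) (n%n≡0 length))

  at-adjacent : ∀ i → Adj G (at i) (at (suc i))
  at-adjacent i = successive (cyclicSuc i)

  at-nonbacktracking : ∀ i → at i ≢ at (suc (suc i))
  at-nonbacktracking i eq =
    CyclicSuc-irreflexive₂ 3≤length (cyclicSuc i) (cyclicSuc (suc i)) (injective eq)

  at-periodic : ∀ i m → at (i + m * length) ≡ at i
  at-periodic i m = cong vertex (Fin.toℕ-injective
    (trans (toℕ-mod (i + m * length)) (trans ([m+kn]%n≡m%n i m length) (sym (toℕ-mod i)))))

  at-toℕ : ∀ i → at (toℕ i) ≡ vertex i
  at-toℕ i = cong vertex (Fin.toℕ-injective (trans (toℕ-mod (toℕ i)) (m<n⇒m%n≡m (Fin.toℕ<n i))))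

  at∈V : ∀ i → at i ∈V C
  at∈V i = i mod length , refl

  at∈E : ∀ i → ⟨ at i , at (suc i) ⟩∈E C
  at∈E i = i mod length , suc i mod length , inj₁ (cyclicSuc i) , refl , refl

  ∈V⇒at : ∀ {v} → v ∈V C → ∃ λ i → v ≡ at i
  ∈V⇒at (i , refl) = toℕ i , sym (at-toℕ i)

  at-late : ∀ i m → ∃ λ j → at (m + j) ≡ at i
  at-late i m = i + (m * length ∸ m) , trans (cong at lemma) (at-periodic i m)
    where
    lemma : m + (i + (m * length ∸ m)) ≡ i + m * length
    lemma = trans (sym (+-assoc m i _)) (trans (cong (_+ (m * length ∸ m)) (+-comm m i))
      (trans (+-assoc i m _) (cong (i +_) (m+[n∸m]≡n (m≤m*n m length)))))

  ∈V⇒at-suc : ∀ {v} → v ∈V C → ∃ λ i → v ≡ at (suc i)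
  ∈V⇒at-suc m with ∈V⇒at m
  ... | i , refl = let (j , eq) = at-late i 1 in j , sym eq

  at-suc : ∀ {i j} → CyclicSuc length i j → at (suc (toℕ i)) ≡ vertex j
  at-suc {i} {j} (inj₁ eq) = trans (cong at eq) (at-toℕ j)
  at-suc {i} {j} (inj₂ (eq , eq₀)) =
    trans (cong at (trans eq (sym (+-identityʳ length))))
      (trans (at-periodic 0 1) (trans (cong at (sym eq₀)) (at-toℕ j)))

  ∈E⇒at : ∀ {u v} → ⟨ u , v ⟩∈E C →
    ∃ λ i → (u ≡ at i × v ≡ at (suc i)) ⊎ (v ≡ at i × u ≡ at (suc i))
  ∈E⇒at (i , j , inj₁ s , refl , refl) = toℕ i , inj₁ (sym (at-toℕ i) , sym (at-suc s))
  ∈E⇒at (i , j , inj₂ s , refl , refl) =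
    toℕ j , inj₂ (sym (at-toℕ j) , sym (at-suc s))

∈E-sym : ∀ {G} (C : Cycle G) {u v} → ⟨ u , v ⟩∈E C → ⟨ v , u ⟩∈E C
∈E-sym C (i , j , s , p , q) = j , i , Sum.swap s , q , p

∈E⇒∈V : ∀ {G} (C : Cycle G) {u v} → ⟨ u , v ⟩∈E C → v ∈V C
∈E⇒∈V C (_ , j , _ , _ , q) = j , q

-- The side of an edge of `G` over which a walk lifted to the product stands after `i` steps from
-- side `b`.
parity : Bool → ℕ → Bool
parity b zero = b
parity b (suc i) = not (parity b i)

parity-not : ∀ b i → parity (not b) i ≡ not (parity b i)
parity-not b zero = refl
parity-not b (suc i) = cong not (parity-not b i)

parity-self : ∀ b i → parity (parity b i) i ≡ b
parity-self b zero = refl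
parity-self b (suc i) = trans (cong not (parity-not (parity b i) i))
  (trans (not-involutive _) (parity-self b i))

parity-even : ∀ b i → parity b (i * 2) ≡ b
parity-even b zero = refl
parity-even b (suc i) = trans (not-involutive _) (parity-even b i)

module EdgeTimes {G H : Graph} (orientable : OnePerfectlyOrientable (G ×ᵍ H))
                 (finH : Finite H) {a₀ a₁ : V G} (a₀a₁ : Adj G a₀ a₁) where
  open Squares {G} {H} orientable using (Arc; oriented; asym; noForkʳ)
  open FiniteGraph finH using (_≟_)

  private
    a : Bool → V G
    a false = a₀
    a true  = a₁

    R : Bool → V H → V H → Set
    R b v w = Arc (a b , v) (a (not b) , w)

    -- Both heads lie over `a (not b)`, so different ones would form a fork. Hence every vertex over
    -- the edge has at most one out-arc within this part of the product.
    R-functional : ∀ b {u v w} → R b u v → R b u w → v ≡ w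
    R-functional b {v = v} {w} p q = decidable-stable (v ≟ w) (noForkʳ p q)

    R-total : ∀ b {u v} → Adj H u v → R b u v ⊎ R (not b) v u
    R-total false uv = oriented (a₀a₁ , uv)
    R-total true  uv = oriented (Graph.sym G a₀a₁ , uv)

    R-asym : ∀ b {u v} → R b u v → ¬ R (not b) v u
    R-asym false = asym
    R-asym true  = asym

  module Lifted (C : Cycle H) where
    open Unrolled C public

    -- Edge number `i` of the lift that starts over `a b`. For a cycle of odd length the lift closes
    -- only after two turns.
    Forward Backward : Bool → ℕ → Set
    Forward  b i = R (parity b i) (at i) (at (suc i))
    Backward b i = R (parity b (suc i)) (at (suc i)) (at i)

    -- The only out-arc at `at (suc i)` goes back to `at i`, so the next edge must enter it.
    backward-suc : ∀ {b i} → Backward b i → Backward b (suc i)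
    backward-suc {b} {i} p with R-total (parity b (suc i)) (at-adjacent (suc i))
    ... | inj₁ q = ⊥-elim (at-nonbacktracking i (R-functional _ p q))
    ... | inj₂ q = q

    backward-+ : ∀ {b i} j → Backward b i → Backward b (j + i)
    backward-+ zero p = p
    backward-+ (suc j) p = backward-suc (backward-+ j p)

    -- A backward arc is followed by backward arcs only, hence by periodicity
    -- the whole lift is directed one way.
    directed : ∀ b → (∀ i → Forward b i) ⊎ (∀ i → Backward b i)
    directed b with R-total b (at-adjacent 0)
    ... | inj₂ p = inj₂ λ i → subst (Backward b) (+-identityʳ i) (backward-+ i p)
    ... | inj₁ p = inj₁ forward
      where
      n = Cycle.length C

      -- A backward arc at any `i` persists up to index `i * 2 * n`. This is an even number of
      -- turns, so the lift is back at its start, where the arc is forward.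
      recur : ∀ i → Backward b (i * 2 * n) → Backward b 0
      recur i q = subst (λ c → R (not c) (at 1) (at 0)) even
        (subst₂ (R _) (at-periodic 1 (i * 2)) (at-periodic 0 (i * 2)) q)
        where
        even : parity b (i * 2 * n) ≡ b
        even = trans (cong (parity b)
          (trans (*-assoc i 2 n) (trans (cong (i *_) (*-comm 2 n)) (sym (*-assoc i n 2)))))
          (parity-even b (i * n))

      forward : ∀ i → Forward b i
      forward i with R-total (parity b i) (at-adjacent i)
      ... | inj₁ q = q
      ... | inj₂ q = ⊥-elim (R-asym b p (recur i
        (subst (Backward b) (m∸n+n≡m i≤) (backward-+ (i * 2 * n ∸ i) q))))
        where
        i≤ : i ≤ i * 2 * n
        i≤ = ≤-trans (m≤m*n i 2) (m≤m*n (i * 2) n)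

    out : ∀ b {v} → v ∈V C → ∃ λ w → ⟨ v , w ⟩∈E C × R b v w
    out b m with ∈V⇒at-suc m
    -- The starting side is chosen so that the lift stands over `a b` at index `suc i`.
    ... | i , refl with directed (parity b (suc i)) | parity-self b (suc i)
    ... | inj₁ fwd | eq =
      _ , at∈E (suc i) , subst (λ c → R c _ _) eq (fwd (suc i))
    ... | inj₂ bwd | eq =
      _ , ∈E-sym C (at∈E i) , subst (λ c → R c _ _) eq (bwd i)

    -- The single out-arc is the one found along the cycle, so following arcs never leaves the
    -- cycle.
    out-stays : ∀ b {v w} → v ∈V C → R b v w → ⟨ v , w ⟩∈E C
    out-stays b m p with out b m
    ... | w , e , q = subst (λ u → ⟨ _ , u ⟩∈E C) (R-functional b q p) e

  private
    data Reaches (C : Cycle H) : Bool → V H → Set where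
      here  : ∀ {b v} → v ∈V C → Reaches C b v
      there : ∀ {b v w} → R b v w → Reaches C (not b) w → Reaches C b v

    -- If the edge is directed towards `w`, it is the only out-arc of its tail. It then either stays
    -- on `C` or is the first arc of the way from `v`, whose remainder starts at `w`.
    reaches-neighbour : ∀ C {v w} → Adj H v w → (∀ b → Reaches C b v) → ∀ b → Reaches C b w
    reaches-neighbour C vw r b with R-total b (Graph.sym H vw)
    ... | inj₁ p = there p (r (not b))
    ... | inj₂ p with r (not b)
    ...   | here m = here (∈E⇒∈V C (Lifted.out-stays C (not b) m p))
    ...   | there q s with R-functional (not b) p q
    ...     | refl = subst (λ c → Reaches C c _) (not-involutive b) s

    reaches : ∀ C {v w} → Star (Adj H) v w → (∀ b → Reaches C b v) → ∀ b → Reaches C b w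
    reaches C ε r = r
    reaches C (p ◅ ps) r = reaches C ps (reaches-neighbour C p r)

    meet : ∀ C D {b v} → Reaches C b v → v ∈V D → ∃ λ w → w ∈V C × w ∈V D
    meet C D (here m) n = _ , m , n
    meet C D {b} (there p r) n = meet C D r (∈E⇒∈V D (Lifted.out-stays D b n p))

    module _ (C D : Cycle H) {w : V H} (w∈C : w ∈V C) (w∈D : w ∈V D) where
      open Lifted C using (at; directed; at-late; at-periodic; ∈V⇒at; ∈E⇒at)

      -- The lift of `C` is directed, so followed from `w` it cannot leave `D`. This gives all later
      -- vertices, or all earlier ones if the lift runs backward; periodicity gives the rest.
      follow : ∀ i → at i ∈V D × ⟨ at i , at (suc i) ⟩∈E D
      follow with directed true | ∈V⇒at w∈C
      ... | inj₁ fwd | k , refl = λ i → good i , Lifted.out-stays D _ (good i) (fwd i)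
        where
        later : ∀ d → at (d + k) ∈V D
        later zero = w∈D
        later (suc d) = ∈E⇒∈V D (Lifted.out-stays D _ (later d) (fwd (d + k)))
        good : ∀ i → at i ∈V D
        good i = let (j , eq) = at-late i k in
          subst (_∈V D) eq (subst (λ m → at m ∈V D) (+-comm j k) (later j))
      ... | inj₂ bwd | k , refl =
        λ i → good i , ∈E-sym D (Lifted.out-stays D _ (good (suc i)) (bwd i))
        where
        earlier : ∀ d {i} → at (d + i) ∈V D → at i ∈V D
        earlier zero m = m
        earlier (suc d) m = earlier d (∈E⇒∈V D (Lifted.out-stays D _ m (bwd _)))
        good : ∀ i → at i ∈V D
        good i = let (j , eq) = at-late k i in
          earlier j (subst (λ m → at m ∈V D) (+-comm i j) (subst (_∈V D) (sym eq) w∈D))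

      V⊆ : ∀ v → v ∈V C → v ∈V D
      V⊆ v m with ∈V⇒at m
      ... | i , refl = proj₁ (follow i)

      E⊆ : ∀ u v → ⟨ u , v ⟩∈E C → ⟨ u , v ⟩∈E D
      E⊆ u v e with ∈E⇒at e
      ... | i , inj₁ (refl , refl) = proj₂ (follow i)
      ... | i , inj₂ (refl , refl) = ∈E-sym D (proj₂ (follow i))

  pseudoforest : Pseudoforest H
  pseudoforest r C D reachC reachD
    with Unrolled.at∈V C 0 | Unrolled.at∈V D 0
  ... | c∈C | d∈D
    with meet C D (reaches C
           (Star.reverse (Graph.sym H) (reachC _ c∈C) ◅◅ reachD _ d∈D)
           (λ b → here c∈C) true) d∈D
  ... | w , w∈C , w∈D =
    (λ v → mk⇔ (V⊆ C D w∈C w∈D v) (V⊆ D C w∈D w∈C v)) ,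
    (λ u v → mk⇔ (E⊆ C D w∈C w∈D u v) (E⊆ D C w∈D w∈C u v))

-- Closing simple paths to cycles

record SimplePath {A : Set} (R : Rel A 0ℓ) (a b : A) : Set where
  field
    length    : ℕ
    vertex    : ℕ → A
    first     : vertex 0 ≡ a
    last      : vertex length ≡ b
    linked    : ∀ {i} → i < length → R (vertex i) (vertex (suc i))
    injective : ∀ {i j} → i ≤ length → j ≤ length → vertex i ≡ vertex j → i ≡ j

module _ {A : Set} {R : Rel A 0ℓ} where

  trivial : ∀ a → SimplePath R a a
  trivial a = record
    { length = 0 ; vertex = λ _ → a ; first = refl ; last = refl
    ; linked = λ () ; injective = λ { z≤n z≤n _ → refl } }

  prepend : ∀ {a b c} → R a b → (P : SimplePath R b c) → let open SimplePath P in
    (∀ {i} → i ≤ length → vertex i ≢ a) → SimplePath R a c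
  prepend {a} r P new = record
    { length = suc length
    ; vertex = vertex′
    ; first = refl
    ; last = last
    ; linked = λ
      { {zero} _ → subst (R a) (sym first) r
      ; {suc i} (s≤s i<) → linked i< }
    ; injective = λ
      { {zero} {zero} _ _ _ → refl
      ; {zero} {suc j} _ (s≤s j≤) eq → ⊥-elim (new j≤ (sym eq))
      ; {suc i} {zero} (s≤s i≤) _ eq → ⊥-elim (new i≤ eq)
      ; {suc i} {suc j} (s≤s i≤) (s≤s j≤) eq → cong suc (injective i≤ j≤ eq) }
    }
    where
    open SimplePath P
    vertex′ : ℕ → A
    vertex′ zero = a
    vertex′ (suc i) = vertex i

  suffix : ∀ {a b} (P : SimplePath R a b) → let open SimplePath P in
    ∀ i → i ≤ length → SimplePath R (vertex i) b
  suffix P i i≤ = record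
    { length = length ∸ i
    ; vertex = λ j → vertex (i + j)
    ; first = cong vertex (+-identityʳ i)
    ; last = trans (cong vertex (m+[n∸m]≡n i≤)) last
    ; linked = λ {j} j< → subst (R (vertex (i + j)) ∘ vertex) (sym (+-suc i j))
        (linked (subst (_≤ length) (+-suc i j) (within-range j<)))
    ; injective = λ j≤ k≤ eq →
        +-cancelˡ-≡ i _ _ (injective (within-range j≤) (within-range k≤) eq)
    }
    where
    open SimplePath P
    within-range : ∀ {j} → j ≤ length ∸ i → i + j ≤ length
    within-range j≤ = subst (_ ≤_) (m+[n∸m]≡n i≤) (+-monoʳ-≤ i j≤)

  -- Loop erasure: when the new first vertex already occurs on the path, only the suffix from there
  -- is kept.
  simplify : DecidableEquality A → ∀ {a b} → Star R a b → SimplePath R a b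
  simplify _≟_ ε = trivial _
  simplify _≟_ {a} (r ◅ rs) with simplify _≟_ rs
  ... | P with anyUpTo? (λ i → SimplePath.vertex P i ≟ a) (suc (SimplePath.length P))
  ... | yes (i , s≤s i≤ , refl) = suffix P i i≤
  ... | no none = prepend r P λ i≤ eq → none (_ , s≤s i≤ , eq)

  prefix-reachable : ∀ {a b} (P : SimplePath R a b) → let open SimplePath P in
    ∀ i → i ≤ length → Star R a (vertex i)
  prefix-reachable P zero _ = subst (Star R _) (sym (SimplePath.first P)) ε
  prefix-reachable P (suc i) i< =
    prefix-reachable P i (≤-trans (m≤n+m i 1) i<) ◅◅ SimplePath.linked P i< ◅ ε

module _ {G : Graph} {R : Rel (V G) 0ℓ} (R⇒Adj : R ⇒ Adj G)
         {a b : V G} (a≢b : a ≢ b) (ba : Adj G b a) (¬Rab : ¬ R a b)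
         (P : SimplePath R a b) where
  open SimplePath P

  private
    -- Since `a ≢ b` and `R a b` fails, closing the path by `ba` gives a cycle and not a doubled
    -- edge.
    2≤length : 2 ≤ length
    2≤length with length | first | last | linked
    ... | zero | f | l | _ = ⊥-elim (a≢b (trans (sym f) l))
    ... | suc zero | f | l | s = ⊥-elim (¬Rab (subst₂ R f l (s (s≤s z≤n))))
    ... | suc (suc _) | _ | _ | _ = s≤s (s≤s z≤n)

    bound : (i : Fin (suc length)) → toℕ i ≤ length
    bound i = m<1+n⇒m≤n (Fin.toℕ<n i)

    link : ∀ {i j} → CyclicSuc (suc length) i j →
      R (vertex (toℕ i)) (vertex (toℕ j)) ⊎ (vertex (toℕ i) ≡ b × vertex (toℕ j) ≡ a)
    link {i} {j} (inj₁ eq) = inj₁ (subst (R _ ∘ vertex) eq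
      (linked (subst (_≤ length) (sym eq) (bound j))))
    link (inj₂ (eq , eq₀)) =
      inj₂ (trans (cong vertex (suc-injective eq)) last , trans (cong vertex eq₀) first)

  closeUp : Cycle G
  closeUp = record
    { length = suc length
    ; 3≤length = s≤s 2≤length
    ; vertex = vertex ∘ toℕ
    ; injective = λ {i} {j} eq → Fin.toℕ-injective (injective (bound i) (bound j) eq)
    ; successive = λ s → [ R⇒Adj , (λ (eq , eq′) → subst₂ (Adj G) (sym eq) (sym eq′) ba) ]′ (link s)
    }

  closeUp-closing : ⟨ b , a ⟩∈E closeUp
  closeUp-closing = Fin.fromℕ length , zero ,
    inj₁ (inj₂ (cong suc (Fin.toℕ-fromℕ length) , refl)) ,
    trans (sym last) (cong vertex (sym (Fin.toℕ-fromℕ length))) , sym first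

  closeUp-edges : {S : Rel (V G) 0ℓ} → Symmetric S → R ⇒ S → S b a →
    ∀ {u v} → ⟨ u , v ⟩∈E closeUp → S u v
  closeUp-edges {S} S-sym R⇒S Sba (i , j , s , refl , refl) =
    [ on , S-sym ∘ on ]′ s
    where
    on : ∀ {i j} → CyclicSuc (suc length) i j → S (vertex (toℕ i)) (vertex (toℕ j))
    on s = [ R⇒S , (λ (eq , eq′) → subst₂ S (sym eq) (sym eq′) Sba) ]′ (link s)

  closeUp-reachable : ∀ {v} → v ∈V closeUp → Star R a v
  closeUp-reachable (i , refl) = prefix-reachable P (toℕ i) (bound i)

-- Orientations of pseudoforests with out-degree at most one

-- A vertex v without out-neighbour has out v ≡ v.
record OutMap (G : Graph) : Set where
  field
    out   : V G → V G
    valid : ∀ v → out v ≡ v ⊎ Adj G v (out v)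
    asym  : ∀ {v} → out (out v) ≡ v → out v ≡ v

  Covers : Rel (V G) 0ℓ
  Covers u v = out u ≡ v ⊎ out v ≡ u

  Fixed : V G → Set
  Fixed v = out v ≡ v

  Step : Rel (V G) 0ℓ
  Step u v = out u ≡ v × u ≢ v

  iter : ℕ → V G → V G
  iter zero v = v
  iter (suc j) v = iter j (out v)

  iter-+ : ∀ i j v → iter (i + j) v ≡ iter j (iter i v)
  iter-+ zero j v = refl
  iter-+ (suc i) j v = iter-+ i j (out v)

  step⇒adj : Step ⇒ Adj G
  step⇒adj {u} (refl , u≢) = [ (λ eq → ⊥-elim (u≢ (sym eq))) , id ]′ (valid u)

  orbit : ∀ j {v} → (∀ {i} → i < j → ¬ Fixed (iter i v)) → Star Step v (iter j v)
  orbit zero _ = ε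
  orbit (suc j) ¬fix = (refl , ≢-sym (¬fix (s≤s z≤n))) ◅ orbit j (¬fix ∘ s≤s)

open OutMap using (out; Covers; Fixed)

infix 4 _≼_
_≼_ : ∀ {G} → Rel (OutMap G) 0ℓ
_≼_ {G} M N = ∀ {u v} → Adj G u v → Covers M u v → Covers N u v

module _ {G : Graph} (fin : Finite G) where
  open FiniteGraph fin

  private
    module Redirect (M : OutMap G) {u w : V G}
                    (ok : w ≡ u ⊎ Adj G u w) (out-w≢u : w ≢ u → out M w ≢ u) where

      out′ : V G → V G
      out′ v with v ≟ u
      ... | yes _ = w
      ... | no _ = out M v

      at-u : out′ u ≡ w
      at-u with u ≟ u
      ... | yes _ = refl
      ... | no u≢u = ⊥-elim (u≢u refl)

      elsewhere : ∀ {v} → v ≢ u → out′ v ≡ out M v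
      elsewhere {v} v≢u with v ≟ u
      ... | yes v≡u = ⊥-elim (v≢u v≡u)
      ... | no _ = refl

      redirect : OutMap G
      redirect = record { out = out′ ; valid = valid′ ; asym = λ {v} → asym′ v }
        where
        valid′ : ∀ v → out′ v ≡ v ⊎ Adj G v (out′ v)
        valid′ v with v ≟ u
        ... | yes refl = ok
        ... | no _ = OutMap.valid M v

        asym′ : ∀ v → out′ (out′ v) ≡ v → out′ v ≡ v
        asym′ v with v ≟ u
        asym′ v | yes refl with w ≟ u
        ... | yes w≡u = λ _ → w≡u
        ... | no w≢u = λ eq → ⊥-elim (out-w≢u w≢u eq)
        asym′ v | no v≢u with out M v ≟ u
        ... | yes eq = λ { refl → ⊥-elim (out-w≢u v≢u eq) }
        ... | no _ = OutMap.asym M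

      covers-redirected : Covers redirect u w
      covers-redirected = inj₁ at-u

      keeps : ∀ {x y} → x ≢ u → out M x ≡ y → Covers redirect x y
      keeps x≢u eq = inj₁ (trans (elsewhere x≢u) eq)

    -- A fixed `u` covers no edge by its own out-value, so redirecting it to `w` loses nothing.
    attach : ∀ (M : OutMap G) {u w} → Fixed M u → Adj G u w → ∃ λ N → M ≼ N × Covers N u w
    attach M {u} {w} fixed uw with out M w ≟ u
    ... | yes eq = M , (λ _ c → c) , inj₂ eq
    ... | no neq = redirect , keep , covers-redirected
      where
      open Redirect M {u} {w} (inj₂ uw) (λ _ → neq)
      half : ∀ {x y} → Dec (x ≡ u) → Adj G x y → out M x ≡ y → Covers redirect x y
      half (no x≢u) xy eq = keeps x≢u eq
      half (yes refl) xy eq = ⊥-elim (Graph.irrefl G (subst (Adj G u) (trans (sym eq) fixed) xy))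
      keep : M ≼ redirect
      keep {x} {y} xy = [ half (x ≟ u) xy , Sum.swap ∘ half (y ≟ u) (Graph.sym G xy) ]′

    -- First `u` is freed, then `r` is pointed at it; in this order no opposite arcs arise on the
    -- way.
    reverseArc : ∀ (M : OutMap G) {u r} → out M u ≡ r → u ≢ r → Fixed M r →
      ∃ λ N → M ≼ N × Fixed N u
    reverseArc M {u} {r} refl u≢r fixed = Second.redirect , keep , u-fixed
      where
      module First = Redirect M {u} {u} (inj₁ refl) (λ u≢u → ⊥-elim (u≢u refl))
      ur : Adj G u r
      ur = OutMap.step⇒adj M (refl , u≢r)
      module Second = Redirect First.redirect {r} {u} (inj₂ (Graph.sym G ur))
        (λ u≢r eq → u≢r (trans (sym First.at-u) eq))
      u-fixed : Fixed Second.redirect u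
      u-fixed = trans (Second.elsewhere u≢r) First.at-u
      half : ∀ {x y} → Dec (x ≡ u) → Dec (x ≡ r) → Adj G x y → out M x ≡ y →
        Covers Second.redirect x y
      half (yes refl) _ xy eq = inj₂ (trans (cong Second.out′ (sym eq)) Second.at-u)
      half (no _) (yes refl) xy eq =
        ⊥-elim (Graph.irrefl G (subst (Adj G r) (trans (sym eq) fixed) xy))
      half (no x≢u) (no x≢r) xy eq = Second.keeps x≢r (trans (First.elsewhere x≢u) eq)
      keep : M ≼ Second.redirect
      keep {x} {y} xy =
        [ half (x ≟ u) (x ≟ r) xy , Sum.swap ∘ half (y ≟ u) (y ≟ r) (Graph.sym G xy) ]′

    -- Induction from the fixed vertex back along the orbit: once `out M u` is free, reversing the
    -- arc into it frees `u`.
    reroot : ∀ j (M : OutMap G) u → Fixed M (OutMap.iter M j u) → ∃ λ N → M ≼ N × Fixed N u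
    reroot zero M u fixed = M , (λ _ c → c) , fixed
    reroot (suc j) M u fixed with u ≟ out M u
    ... | yes eq = M , (λ _ c → c) , sym eq
    ... | no u≢r with reroot j M (out M u) fixed
    ... | N , M≼N , r-fixed with M≼N (OutMap.step⇒adj M (refl , u≢r)) (inj₁ refl)
    ... | inj₂ eq = ⊥-elim (u≢r (trans (sym eq) r-fixed))
    ... | inj₁ eq with reverseArc N eq u≢r r-fixed
    ... | N′ , N≼N′ , u-fixed = N′ , (λ xy c → N≼N′ xy (M≼N xy c)) , u-fixed

    rerootAndAttach : ∀ (M : OutMap G) j {u v} → Fixed M (OutMap.iter M j u) → Adj G u v →
      ∃ λ N → M ≼ N × Covers N u v
    rerootAndAttach M j {u} fx uv with reroot j M u fx
    ... | N , M≼N , fixed with attach N fixed uv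
    ... | N′ , N≼N′ , c = N′ , (λ xy → N≼N′ xy ∘ M≼N xy) , c

    record OrbitCycle (M : OutMap G) (u : V G) : Set where
      field
        cycle     : Cycle G
        covered   : ∀ {x y} → ⟨ x , y ⟩∈E cycle → Covers M x y
        reachable : ∀ {v} → v ∈V cycle → Star (OutMap.Step M) u v

    -- By the pigeonhole principle two of the first `suc (order fin)` iterates agree. The orbit from
    -- the successor of the repeated vertex back to it, made simple, closes to a cycle; `asym` rules
    -- out length two.
    orbitCycle : ∀ (M : OutMap G) u → (∀ {i} → i < suc (order fin) → ¬ Fixed M (OutMap.iter M i u)) →
      OrbitCycle M u
    orbitCycle M u ¬fix
      with Fin.pigeonhole ≤-refl (λ (i : Fin (suc (order fin))) → index (OutMap.iter M (toℕ i) u))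
    ... | i , j , i<j , eq = record
      { cycle = closeUp step⇒adj a≢b ba ¬Rab P
      ; covered = closeUp-edges {G = G} step⇒adj a≢b ba ¬Rab P Sum.swap (inj₁ ∘ proj₁) (inj₁ refl)
      ; reachable = λ m → orbit (toℕ i) (λ p → ¬fix (≤-trans p (<⇒≤ (Fin.toℕ<n i))))
          ◅◅ (refl , ≢-sym a≢b) ◅ closeUp-reachable {G = G} step⇒adj a≢b ba ¬Rab P m
      }
      where
      open OutMap M hiding (out; Covers; Fixed)
      w = iter (toℕ i) u
      d = toℕ j ∸ suc (toℕ i)
      a≢b : out M w ≢ w
      a≢b = ¬fix (Fin.toℕ<n i)
      ba : Adj G w (out M w)
      ba = step⇒adj (refl , ≢-sym a≢b)
      ¬Rab : ¬ Step (out M w) w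
      ¬Rab (p , _) = a≢b (asym p)
      i+1+d≡j : toℕ i + suc d ≡ toℕ j
      i+1+d≡j = trans (+-suc (toℕ i) d) (m+[n∸m]≡n i<j)
      returns : iter (suc d) w ≡ w
      returns = trans (sym (iter-+ (toℕ i) (suc d) u))
        (trans (cong (λ n → iter n u) i+1+d≡j) (sym (index-injective eq)))
      ¬fix′ : ∀ {t} → t < d → ¬ Fixed M (iter (suc t) w)
      ¬fix′ {t} t<d = subst (¬_ ∘ Fixed M) (iter-+ (toℕ i) (suc t) u)
        (¬fix (≤-trans (s≤s (≤-trans (+-monoʳ-≤ (toℕ i) (≤-trans t<d (m≤n+m d 1)))
          (≤-reflexive i+1+d≡j))) (Fin.toℕ<n j)))
      P : SimplePath Step (out M w) w
      P = simplify _≟_ (subst (Star Step (out M w)) returns (orbit d ¬fix′))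

  module _ (pf : Pseudoforest G) where

    private
      fixedOrbit? : ∀ (M : OutMap G) u →
        Dec (∃ λ j → j < suc (order fin) × Fixed M (OutMap.iter M j u))
      fixedOrbit? M u = anyUpTo? (λ j → out M (OutMap.iter M j u) ≟ OutMap.iter M j u) _

      -- If the orbits of both ends of an uncovered edge uv run into cycles, these
      -- coincide. So covered edges join u to v; together with uv they contain a
      -- second cycle in the same component.
      covered-orbits : ∀ (M : OutMap G) {u v} → Adj G u v →
        OrbitCycle M u → OrbitCycle M v → Covers M u v
      covered-orbits M {u} {v} uv cu cv with OutMap.out M u ≟ v | OutMap.out M v ≟ u
      ... | yes p | _ = inj₁ p
      ... | no _ | yes p = inj₂ p
      ... | no ¬p | no ¬q = ⊥-elim (¬c (Sum.swap (C.covered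
              (Equivalence.from (proj₂ C≈E v u) (closeUp-closing {G = G} joined⇒adj u≢v vu ¬Juv P)))))
        where
        module C = OrbitCycle cu
        module D = OrbitCycle cv
        ¬c : ¬ Covers M u v
        ¬c = [ ¬p , ¬q ]′
        Joined : Rel (V G) 0ℓ
        Joined x y = OutMap.Step M x y ⊎ OutMap.Step M y x
        joined⇒adj : Joined ⇒ Adj G
        joined⇒adj = [ OutMap.step⇒adj M , Graph.sym G ∘ OutMap.step⇒adj M ]′
        u≢v : u ≢ v
        u≢v refl = Graph.irrefl G uv
        vu = Graph.sym G uv
        ¬Juv : ¬ Joined u v
        ¬Juv = [ ¬p ∘ proj₁ , ¬q ∘ proj₁ ]′
        reachC : ∀ w → w ∈V C.cycle → Star (Adj G) u w
        reachC w m = Star.map (OutMap.step⇒adj M) (C.reachable m)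
        reachD : ∀ w → w ∈V D.cycle → Star (Adj G) u w
        reachD w m = uv ◅ Star.map (OutMap.step⇒adj M) (D.reachable m)
        C≈D : C.cycle ≈ᶜ D.cycle
        C≈D = pf u C.cycle D.cycle reachC reachD
        common : Unrolled.at C.cycle 0 ∈V C.cycle
        common = Unrolled.at∈V C.cycle 0
        -- From `u` along its orbit to a vertex of the common cycle, then back along the orbit of
        -- `v`.
        P : SimplePath Joined u v
        P = simplify _≟_ (Star.map inj₁ (C.reachable common) ◅◅
          Star.reverse inj₂ (D.reachable (Equivalence.to (proj₁ C≈D _) common)))
        E : Cycle G
        E = closeUp joined⇒adj u≢v vu ¬Juv P
        C≈E : C.cycle ≈ᶜ E
        C≈E = pf u C.cycle E reachC
          (λ w m → Star.map joined⇒adj (closeUp-reachable {G = G} joined⇒adj u≢v vu ¬Juv P m))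

      addEdge : ∀ (M : OutMap G) {u v} → Adj G u v → ∃ λ N → M ≼ N × Covers N u v
      addEdge M {u} {v} uv with fixedOrbit? M u | fixedOrbit? M v
      ... | no ¬fu | no ¬fv = M , (λ _ c → c) , covered-orbits M uv
              (orbitCycle M u λ i< fx → ¬fu (_ , i< , fx))
              (orbitCycle M v λ i< fx → ¬fv (_ , i< , fx))
      ... | yes (j , _ , fx) | _ = rerootAndAttach M j fx uv
      ... | no _ | yes (j , _ , fx) =
        let (N , M≼N , c) = rerootAndAttach M j fx (Graph.sym G uv) in
        N , M≼N , Sum.swap c

      covering : (es : List (V G × V G)) →
        ∃ λ (M : OutMap G) → All (λ (u , v) → Adj G u v → Covers M u v) es
      covering [] = record { out = id ; valid = λ _ → inj₁ refl ; asym = λ _ → refl } , []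
      covering ((u , v) ∷ es) with covering es | adj? u v
      ... | M , cs | no ¬uv = M , (λ uv → ⊥-elim (¬uv uv)) ∷ cs
      ... | M , cs | yes uv with addEdge M uv
      ... | N , M≼N , c = N , (λ _ → c) ∷ All.map (λ f xy → M≼N xy (f xy)) cs

    pseudoforest⇒outMap : ∃ λ (M : OutMap G) → ∀ {u v} → Adj G u v → Covers M u v
    pseudoforest⇒outMap with covering (cartesianProduct vertices vertices)
    ... | M , cs = M , λ {u} {v} →
      All.lookup cs (∈-cartesianProduct⁺ (∈-vertices u) (∈-vertices v))

-- Orientations of the direct product

-- A linear forest mapped into disjoint copies of the path with `k` vertices, shorter components
-- filling an initial segment. An orientation for full paths can be pulled back along this map.
record Layout (k : ℕ) (G : Graph) : Set where
  field
    {size}    : ℕ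
    component : V G → Fin size
    position  : V G → Fin k
    injective : ∀ {u v} → component u ≡ component v → position u ≡ position v → u ≡ v
    adjacent₁ : ∀ {u v} → Adj G u v → component u ≡ component v
    adjacent₂ : ∀ {u v} → Adj G u v → Adj (path k) (position u) (position v)

layout : ∀ {k G} → LinearForest k G → Layout k G
layout {k} {G} (m , ℓ , bounds , iso) = record
  { component = component
  ; position  = position
  ; injective = λ {u} {v} p q → to-injective (Σ-injective (to u) (to v) p q)
  ; adjacent₁ = λ {u} {v} uv → adj₁ (Equivalence.to (adjacency u v) uv)
  ; adjacent₂ = λ {u} {v} uv → adj₂ (Equivalence.to (adjacency u v) uv)
  }
  where
  open _≅_ iso
  open Inverse bijection using (to; from; strictlyInverseʳ)

  W : Set
  W = Σ (Fin m) (Fin ∘ ℓ)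

  place : W → Fin k
  place (i , a) = Fin.inject≤ a (proj₂ (bounds i))

  component : V G → Fin m
  component v = proj₁ (to v)

  position : V G → Fin k
  position v = place (to v)

  to-injective : ∀ {u v} → to u ≡ to v → u ≡ v
  to-injective {u} {v} eq =
    trans (sym (strictlyInverseʳ u)) (trans (cong from eq) (strictlyInverseʳ v))

  Σ-injective : ∀ (x y : W) → proj₁ x ≡ proj₁ y → place x ≡ place y → x ≡ y
  Σ-injective (i , a) (.i , b) refl eq = cong (i ,_) (Fin.inject≤-injective _ _ a b eq)

  adj₁ : ∀ {x y} → ⨆Adj (path ∘ ℓ) x y → proj₁ x ≡ proj₁ y
  adj₁ (within i _) = refl

  adj₂ : ∀ {x y} → ⨆Adj (path ∘ ℓ) x y → Adj (path k) (place x) (place y)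
  adj₂ (within i {a} {b} p)
    rewrite Fin.toℕ-inject≤ a (proj₂ (bounds i)) | Fin.toℕ-inject≤ b (proj₂ (bounds i)) = p

linearForest₁-edgeless : ∀ {G} → LinearForest 1 G → ∀ {u v} → ¬ Adj G u v
linearForest₁-edgeless F uv = path₁ _ _ (Layout.adjacent₂ (layout F) uv)
  where
  path₁ : ∀ i j → ¬ Adj (path 1) i j
  path₁ 0F 0F (inj₁ ())
  path₁ 0F 0F (inj₂ ())

linearForest₂-functional : ∀ {G} → LinearForest 2 G →
  ∀ {u v w} → Adj G u v → Adj G u w → v ≡ w
linearForest₂-functional F uv uw = injective
  (trans (sym (adjacent₁ uv)) (adjacent₁ uw))
  (path₂ _ _ _ (adjacent₂ uv) (adjacent₂ uw))
  where
  open Layout (layout F)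
  path₂ : ∀ i j k → Adj (path 2) i j → Adj (path 2) i k → j ≡ k
  path₂ _ 0F 0F _ _ = refl
  path₂ _ 1F 1F _ _ = refl
  path₂ 0F 0F 1F (inj₁ ())
  path₂ 0F 0F 1F (inj₂ ())
  path₂ 1F 0F 1F _ (inj₁ ())
  path₂ 1F 0F 1F _ (inj₂ ())
  path₂ 0F 1F 0F _ (inj₁ ())
  path₂ 0F 1F 0F _ (inj₂ ())
  path₂ 1F 1F 0F (inj₁ ())
  path₂ 1F 1F 0F (inj₂ ())

edgeless-× : ∀ {G H} → LinearForest 1 G → OnePerfectlyOrientable (G ×ᵍ H)
edgeless-× F = record
  { Arc = λ _ _ → ⊥
  ; arc⇒adj = λ ()
  ; oriented = λ (uv , _) → ⊥-elim (linearForest₁-edgeless F uv)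
  ; asym = λ ()
  } , λ _ ()

-- The only possible out-neighbour of `(a , u)` pairs the partner of `a` in the matching with
-- `out M u`.
matching-×-pseudoforest : ∀ {G H} → Finite H → LinearForest 2 G → Pseudoforest H →
  OnePerfectlyOrientable (G ×ᵍ H)
matching-×-pseudoforest {G} {H} finH F pf with pseudoforest⇒outMap finH pf
... | M , covers = record
  { Arc = λ (a , u) (b , v) → Adj G a b × Adj H u v × out M u ≡ v
  ; arc⇒adj = λ (ab , uv , _) → ab , uv
  ; oriented = λ (ab , uv) → Sum.map
      (λ eq → ab , uv , eq)
      (λ eq → Graph.sym G ab , Graph.sym H uv , eq)
      (covers uv)
  ; asym = λ { (_ , uv , refl) (_ , _ , eq) →
      Graph.irrefl H (subst (Adj H _) (OutMap.asym M eq) uv) }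
  } , λ _ (ab , _ , eq) (ac , _ , eq′) u≢v →
    ⊥-elim (u≢v (cong₂ _,_ (linearForest₂-functional F ab ac) (trans (sym eq) eq′)))

-- Each of the two components of P₃ × P₄ consists of a 4-cycle and two pendant edges.
flow : Fin 3 × Fin 4 → Fin 3 × Fin 4
flow (0F , 0F) = 1F , 1F
flow (2F , 0F) = 1F , 1F
flow (1F , 1F) = 0F , 2F
flow (0F , 2F) = 1F , 3F
flow (1F , 3F) = 2F , 2F
flow (2F , 2F) = 1F , 1F
flow (0F , 3F) = 1F , 2F
flow (2F , 3F) = 1F , 2F
flow (1F , 2F) = 0F , 1F
flow (0F , 1F) = 1F , 0F
flow (1F , 0F) = 2F , 1F
flow (2F , 1F) = 1F , 2F

flow-covers : ∀ i i′ j j′ → Adj (path 3) i i′ → Adj (path 4) j j′ →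
  flow (i , j) ≡ (i′ , j′) ⊎ flow (i′ , j′) ≡ (i , j)
flow-covers = from-yes (Fin.all? λ i → Fin.all? λ i′ → Fin.all? λ j → Fin.all? λ j′ →
  path? i i′ →-dec (path? j j′ →-dec (flow (i , j) ≟² (i′ , j′) ⊎-dec flow (i′ , j′) ≟² (i , j))))
  where
  path? : ∀ {n} (i j : Fin n) → Dec (Adj (path n) i j)
  path? i j = suc (toℕ i) ℕ.≟ toℕ j ⊎-dec suc (toℕ j) ℕ.≟ toℕ i
  infix 4 _≟²_
  _≟²_ : DecidableEquality (Fin 3 × Fin 4)
  _≟²_ = ≡-dec Fin._≟_ Fin._≟_

flow-asym : ∀ i j → flow (flow (i , j)) ≢ (i , j)
flow-asym = from-yes (Fin.all? λ i → Fin.all? λ j →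
  ¬? (≡-dec Fin._≟_ Fin._≟_ (flow (flow (i , j))) (i , j)))

-- `flow` is pulled back along the layouts. A component and a position determine a vertex, so
-- out-neighbourhoods have at most one element.
linearForest₃-×-linearForest₄ : ∀ {G H} → LinearForest 3 G → LinearForest 4 H →
  OnePerfectlyOrientable (G ×ᵍ H)
linearForest₃-×-linearForest₄ {G} {H} F₃ F₄ = record
  { Arc = λ x y → Adj (G ×ᵍ H) x y × flow (place x) ≡ place y
  ; arc⇒adj = proj₁
  ; oriented = λ p@(ab , uv) → Sum.map (p ,_) (Graph.sym (G ×ᵍ H) p ,_)
      (flow-covers _ _ _ _ (L.adjacent₂ ab) (M.adjacent₂ uv))
  ; asym = λ (_ , eq) (_ , eq′) →
      flow-asym _ _ (trans (cong flow eq) eq′)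
  } , λ _ ((ab , uv) , eq) ((ac , uw) , eq′) x≢y →
    let same = trans (sym eq) eq′ in ⊥-elim (x≢y (cong₂ _,_
      (L.injective (trans (sym (L.adjacent₁ ab)) (L.adjacent₁ ac)) (cong proj₁ same))
      (M.injective (trans (sym (M.adjacent₁ uv)) (M.adjacent₁ uw)) (cong proj₂ same))))
  where
  module L = Layout (layout F₃)
  module M = Layout (layout F₄)
  place : V (G ×ᵍ H) → Fin 3 × Fin 4
  place (a , u) = L.position a , M.position u

-- Combining the obstructions and the orientations

claw⇒NBWalk₂ : ∀ {G v} → Claw G v → ∃₂ (NBWalk G 2)
claw⇒NBWalk₂ {G} (x , y , _ , vx , vy , _ , x≢y , _) =
  x , _ , step (Graph.sym G vx) x≢y (edge vy)

bothNBWalk₂ : ∀ {G H} → Finite G → Finite H → OnePerfectlyOrientable (G ×ᵍ H) →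
  ∃₂ (NBWalk G 2) → ∃₂ (NBWalk H 2) →
  (LinearForest 3 G × LinearForest 4 H) ⊎ (LinearForest 3 H × LinearForest 4 G)
bothNBWalk₂ {G} {H} finG finH ori (_ , _ , g) (_ , _ , h) = split
  where
  module S = Squares {G} {H} ori
  module T = Squares {H} {G} (×ᵍ-swap {G} {H} ori)

  -- Triangles in both factors exclude each other, and a triangle in `G` alone carries a walk with 4
  -- edges, which a triangle-free `H` forbids.
  ¬△G : ¬ Triangle G
  ¬△G t with triangle? finH
  ... | yes t′ = S.noTriangles t t′
  ... | no ¬△H = T.noNBWalk₄ ¬△H h (proj₂ (proj₂ (triangle⇒NBWalk₄ t)))

  ¬△H : ¬ Triangle H
  ¬△H t = S.noNBWalk₄ ¬△G g (proj₂ (proj₂ (triangle⇒NBWalk₄ t)))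

  G₄ : LinearForest 4 G
  G₄ = linearForest finG (T.noClaw h) (T.noNBWalk₄ ¬△H h)

  H₄ : LinearForest 4 H
  H₄ = linearForest finH (S.noClaw g) (S.noNBWalk₄ ¬△G g)

  split : (LinearForest 3 G × LinearForest 4 H) ⊎ (LinearForest 3 H × LinearForest 4 G)
  split with hasNBWalk? finG 3
  ... | no ¬g₃ = inj₁ (linearForest finG (T.noClaw h) (λ w → ¬g₃ (_ , _ , w)) , H₄)
  ... | yes (_ , _ , g₃) = inj₂ (linearForest finH (S.noClaw g) (S.noNBWalk₃₃ ¬△G g₃) , G₄)

edgeless⇒linearForest : ∀ {G} → Finite G → ¬ ∃₂ (NBWalk G 1) → LinearForest 1 G
edgeless⇒linearForest finG none = linearForest finG
  (λ { (_ , _ , _ , vx , _) → none (_ , _ , edge vx) }) (λ w → none (_ , _ , w))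

noNBWalk₂⇒linearForest : ∀ {G} → Finite G → ¬ ∃₂ (NBWalk G 2) → LinearForest 2 G
noNBWalk₂⇒linearForest finG none = linearForest finG
  (none ∘ claw⇒NBWalk₂) (λ w → none (_ , _ , w))

nbWalk₁⇒adj : ∀ {G u v} → NBWalk G 1 u v → Adj G u v
nbWalk₁⇒adj (edge p) = p
nbWalk₁⇒adj (step _ _ ())

theorem11 : (G H : Graph) (finG : Finite G) (finH : Finite H) →
    2 ≤ order finG → 2 ≤ order finH →
    OnePerfectlyOrientable (G ×ᵍ H) ⇔
    ( (LinearForest 1 G ⊎ LinearForest 1 H)
    ⊎ ((LinearForest 2 G × Pseudoforest H) ⊎ (LinearForest 2 H × Pseudoforest G))
    ⊎ ((LinearForest 3 G × LinearForest 4 H) ⊎ (LinearForest 3 H × LinearForest 4 G)))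
theorem11 G H finG finH _ _ = mk⇔ classify orient
  where
  classify : OnePerfectlyOrientable (G ×ᵍ H) → _
  -- A factor without walks of one edge is edgeless; one without walks of two edges is a matching,
  -- and as it has an edge, the other factor is a pseudoforest.
  classify ori with hasNBWalk? finG 1 | hasNBWalk? finH 1
  ... | no ¬g | _ = inj₁ (inj₁ (edgeless⇒linearForest finG ¬g))
  ... | yes _ | no ¬h = inj₁ (inj₂ (edgeless⇒linearForest finH ¬h))
  ... | yes (_ , _ , g) | yes (_ , _ , h) with hasNBWalk? finG 2 | hasNBWalk? finH 2
  ... | no ¬g₂ | _ = inj₂ (inj₁ (inj₁ (noNBWalk₂⇒linearForest finG ¬g₂ ,
          EdgeTimes.pseudoforest {G} {H} ori finH (nbWalk₁⇒adj g))))
  ... | yes _ | no ¬h₂ = inj₂ (inj₁ (inj₂ (noNBWalk₂⇒linearForest finH ¬h₂ ,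
          EdgeTimes.pseudoforest {H} {G} (×ᵍ-swap {G} {H} ori) finG (nbWalk₁⇒adj h))))
  ... | yes g₂ | yes h₂ = inj₂ (inj₂ (bothNBWalk₂ finG finH ori g₂ h₂))

  orient : _ → OnePerfectlyOrientable (G ×ᵍ H)
  orient (inj₁ (inj₁ F)) = edgeless-× {G} {H} F
  orient (inj₁ (inj₂ F)) = ×ᵍ-swap {H} {G} (edgeless-× {H} {G} F)
  orient (inj₂ (inj₁ (inj₁ (F , pf)))) = matching-×-pseudoforest finH F pf
  orient (inj₂ (inj₁ (inj₂ (F , pf)))) = ×ᵍ-swap {H} {G} (matching-×-pseudoforest finG F pf)
  orient (inj₂ (inj₂ (inj₁ (F₃ , F₄)))) = linearForest₃-×-linearForest₄ F₃ F₄
  orient (inj₂ (inj₂ (inj₂ (F₃ , F₄)))) = ×ᵍ-swap {H} {G} (linearForest₃-×-linearForest₄ F₃ F₄)
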